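{- Let $c\ge 1$ and $n_1\ge n_2\ge\cdots\ge n_c\ge 1$ be integers. Let $G$ be a complete graph on $n$ vertices, where $n\ge n_1+\sum_{i=1}^{c}(n_i-1)$, whose edges are each colored with one of the colors $1,2,\ldots,c$. Suppose that for every $i\in\{1,\ldots,c\}$, $G$ contains no matching consisting of $n_i$ edges all of color $i$. Then $n=n_1+\sum_{i=1}^{c}(n_i-1)$, and the colors of $G$ can be relabeled so that: (a) $V(G)$ can be partitioned into $c$ parts $V_1,V_2,\ldots,V_c$ with $|V_1|=2n_1-1$ and $|V_i|=n_i-1$ for $i\in\{2,\ldots,c\}$, such that all edges with both ends in $V_i$ have color $i$, for each $i\in\{1,\ldots,c\}$; (b) for each $i\in\{2,\ldots,c\}$, all edges with one end in $V_1$ and the other end in $V_i$ have color $i$; (c) for distinct $i,j\in\{2,\ldots,c\}$, every edge with one end in $V_i$ and the other end in $V_j$ has color $i$ or color $j$.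
   Context: All graphs are finite and simple. $n_iK_2$ denotes a matching of size $n_i$ (i.e., $n_i$ pairwise vertex-disjoint edges). A $c$-edge-coloring assigns to each edge one of $c$ colors; colors need not all be used. -}

module Defs where

open import Data.Nat using (ℕ; zero; suc; _+_; _*_; _∸_; _≤_)
open import Data.Fin using (Fin; zero; suc)
import Data.Fin as F
open import Data.Product using (Σ; _×_; _,_; proj₁; proj₂)
open import Data.Sum using (_⊎_)
open import Relation.Binary.PropositionalEquality using (_≡_; _≢_)
open import Function.Bundles using (_↔_)
open import Data.Fin.Permutation using (Permutation′; _⟨$⟩ʳ_)

sumFin : ∀ {c} → (Fin c → ℕ) → ℕ
sumFin {zero} f = 0
sumFin {suc c} f = f zero + sumFin (λ i → f (suc i))

-- An edge colouring of the complete graph K_n with colours Fin c: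
-- col u v is the colour of the edge uv (u ≢ v); col is required symmetric.
Coloring : ℕ → ℕ → Set
Coloring n c = Fin n → Fin n → Fin c

Symmetric : ∀ {n c} → Coloring n c → Set
Symmetric col = ∀ u v → col u v ≡ col v u

MonoMatching : ∀ {n c} → Coloring n c → Fin c → ℕ → Set
MonoMatching {n} col i m =
  Σ (Fin m → Fin n × Fin n) λ e →
    (∀ k → proj₁ (e k) ≢ proj₂ (e k)) ×
    (∀ k → col (proj₁ (e k)) (proj₂ (e k)) ≡ i) ×
    (∀ k l → k ≢ l →
       (proj₁ (e k) ≢ proj₁ (e l)) × (proj₁ (e k) ≢ proj₂ (e l)) ×
       (proj₂ (e k) ≢ proj₁ (e l)) × (proj₂ (e k) ≢ proj₂ (e l)))

recolor : ∀ {n c} → Permutation′ c → Coloring n c → Coloring n c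
recolor σ col u v = σ ⟨$⟩ʳ col u v

-- Number of vertices of the extremal part i (colour zero plays the role of colour 1).
partSize : ∀ {c} → (Fin (suc c) → ℕ) → Fin (suc c) → ℕ
partSize ns zero = 2 * ns zero ∸ 1
partSize ns (suc i) = ns (suc i) ∸ 1

-- Conditions (a)–(c) for a colouring col and a part assignment p : V → Fin (suc c)
-- (V_i = p⁻¹(i)); index zero is V_1.
Extremal : ∀ {n c} → (Fin (suc c) → ℕ) → Coloring n (suc c) → (Fin n → Fin (suc c)) → Set
Extremal {n} {c} ns col p =
  (∀ i → Fin (partSize ns i) ↔ Σ (Fin n) (λ v → p v ≡ i)) ×
  (∀ u v → u ≢ v → p u ≡ p v → col u v ≡ p u) ×
  (∀ u v → p u ≡ zero → p v ≢ zero → col u v ≡ p v) ×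
  (∀ u v → p u ≢ zero → p v ≢ zero → p u ≢ p v → (col u v ≡ p u) ⊎ (col u v ≡ p v))

module Submission where

-- Put kᵢ = nᵢ − 1, S = Σ kᵢ, M = max kᵢ, and induct on n ≥ S + M + 1.
-- If deleting some vertex v destroys all kᵢ-matchings of a colour i, then lower kᵢ
-- by one and apply induction to the rest: an edge vu of a wrong colour j would
-- extend a kⱼ-matching avoiding u that the extremal structure contains, so v can
-- be added to part i.
-- Otherwise every vertex is missed by a maximum matching of every colour, and by
-- Gallai's lemma "no maximum matching of colour i misses both u and v" is an
-- equivalence relation containing colour i. A maximum matching misses at most one
-- vertex of each class, so at most 2kᵢ(2kᵢ + 1) ordered pairs are equivalent, whence
-- n(n − 1) ≤ Σ 2kᵢ(2kᵢ + 1). This forces n = S + M + 1 and either a single colour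
-- with kᵢ ≠ 0, or n = 4 and two colours with kᵢ = 1. In the latter case K₄ would be
-- covered by two equivalence relations, one of which would then be total.

open import Defs
open import Data.Nat hiding (_≟_)
open import Data.Nat.Properties hiding (_≟_)
open import Data.Nat.Tactic.RingSolver using (solve-∀)
open import Data.Fin using (Fin; zero; suc; punchIn; punchOut)
open import Data.Fin.Properties using (_≟_; any?; punchIn-injective; punchInᵢ≢i; punchIn-punchOut)
import Data.Fin as F
open import Data.Fin.Permutation using (Permutation′; transpose; _⟨$⟩ʳ_; _⟨$⟩ˡ_; inverseˡ; inverseʳ)
open import Data.Vec.Functional using (insertAt)
open import Data.Vec.Functional.Properties using (insertAt-lookup; insertAt-punchIn)
import Data.Sum as Sum
open import Data.Bool.Base using (if_then_else_)
open import Data.Empty using (⊥; ⊥-elim)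
open import Data.Product using (Σ; ∃; ∃₂; _×_; _,_; proj₁; proj₂)
open import Data.Sum using (_⊎_; inj₁; inj₂)
open import Function.Base using (_∘_; id)
open import Function.Bundles using (_↔_; mk↔ₛ′; Inverse)
open import Function.Definitions using (Injective)
open import Level using (0ℓ)
open import Relation.Binary.Core using (Rel)
import Relation.Binary.Definitions as B
open import Relation.Binary.PropositionalEquality using (_≡_; _≢_; refl; sym; trans; cong; cong₂; subst; module ≡-Reasoning)
open import Relation.Nullary using (¬_; Dec; yes; no; does; contradiction)
open import Relation.Nullary.Decidable using (_×-dec_; _⊎-dec_; ¬?)
open import Relation.Unary using (Pred; Decidable; _⊆_; U; _∪_)
open import Algebra.Properties.Semiring.Sum +-*-semiring using (sum; sum-remove; ∑-comm; ∑-distrib-+; *-distribˡ-sum; *-distribʳ-sum; sum-cong-≗)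

private variable
  n m k : ℕ
  P Q A B : Pred (Fin n) 0ℓ

sum-mono : {f g : Fin n → ℕ} → (∀ i → f i ≤ g i) → sum f ≤ sum g
sum-mono {zero} h = z≤n
sum-mono {suc n} h = +-mono-≤ (h zero) (sum-mono (h ∘ suc))

sum-const : ∀ n x → sum {n} (λ _ → x) ≡ n * x
sum-const zero x = refl
sum-const (suc n) x = cong (x +_) (sum-const n x)

sum-zero : {f : Fin n → ℕ} → (∀ i → f i ≡ 0) → sum f ≡ 0
sum-zero {zero} h = refl
sum-zero {suc n} h rewrite h zero = sum-zero (h ∘ suc)

≤-sum : (f : Fin n → ℕ) → ∀ i → f i ≤ sum f
≤-sum f zero = m≤m+n _ _
≤-sum f (suc i) = ≤-trans (≤-sum (f ∘ suc) i) (m≤n+m _ _)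

sumFin≡sum : (f : Fin n → ℕ) → sumFin f ≡ sum f
sumFin≡sum {zero} f = refl
sumFin≡sum {suc n} f = cong (f zero +_) (sumFin≡sum (f ∘ suc))

ind : ∀ {a} {X : Set a} → Dec X → ℕ
ind d = if does d then 1 else 0

ind-mono : ∀ {X Y : Set} (d : Dec X) (e : Dec Y) → (X → Y) → ind d ≤ ind e
ind-mono (no _) e f = z≤n
ind-mono (yes x) (yes _) f = ≤-refl
ind-mono (yes x) (no ¬y) f = contradiction (f x) ¬y

ind-no : ∀ {X : Set} (d : Dec X) → ¬ X → ind d ≡ 0
ind-no (no _) ¬x = refl
ind-no (yes x) ¬x = contradiction x ¬x

ind-yes : ∀ {X : Set} (d : Dec X) → X → ind d ≡ 1
ind-yes (yes _) x = refl
ind-yes (no ¬x) x = contradiction x ¬x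

count : Decidable P → ℕ
count P? = sum (λ z → ind (P? z))

count-cong : (P? : Decidable P) (Q? : Decidable Q) → P ⊆ Q → Q ⊆ P → count P? ≡ count Q?
count-cong P? Q? f g =
  ≤-antisym (sum-mono λ z → ind-mono (P? z) (Q? z) f) (sum-mono λ z → ind-mono (Q? z) (P? z) g)

count-none : (P? : Decidable P) → (∀ z → ¬ P z) → count P? ≡ 0
count-none P? h = sum-zero (λ z → ind-no (P? z) (h z))

count-all : (P? : Decidable {A = Fin n} P) → (∀ z → P z) → count P? ≡ n
count-all {n = n} P? h =
  trans (sum-cong-≗ (λ z → ind-yes (P? z) (h z))) (trans (sum-const n 1) (*-identityʳ n))

count-singleton : (a : Fin n) → count (_≟ a) ≡ 1
count-singleton {suc n} zero = cong suc (count-none (λ z → suc z ≟ zero {n}) (λ _ ()))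
count-singleton (suc a) = count-singleton a

count-subsingleton : ∀ {X : Set} (P? : Decidable {A = Fin n} P) (X? : Dec X) →
  (∀ z → P z → X) → (∀ {y z} → P y → P z → y ≡ z) → count P? ≤ ind X?
count-subsingleton P? X? f unique with any? P?
... | no ¬p = ≤-trans (≤-reflexive (count-none P? (λ z p → ¬p (z , p)))) z≤n
... | yes (a , p) = ≤-trans (sum-mono λ z → ind-mono (P? z) (z ≟ a) (λ q → unique q p))
  (≤-reflexive (trans (count-singleton a) (sym (ind-yes X? (f a p)))))

count-↔ : (P? : Decidable {A = Fin n} P) → (∀ {z} → (p q : P z) → p ≡ q) → Fin (count P?) ↔ Σ (Fin n) P
count-↔ {zero} P? irr = mk↔ₛ′ (λ ()) (λ ()) (λ ()) (λ ())
count-↔ {suc n} {P} P? irr = go (P? zero)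
  where
  open Inverse (count-↔ (P? ∘ suc) irr)
  go : (d : Dec (P zero)) → Fin (ind d + count (P? ∘ suc)) ↔ Σ (Fin (suc n)) P
  go (yes p) = mk↔ₛ′
    (λ { zero → zero , p ; (suc i) → suc (proj₁ (to i)) , proj₂ (to i) })
    (λ { (zero , _) → zero ; (suc v , q) → suc (from (v , q)) })
    (λ { (zero , q) → cong (zero ,_) (irr p q)
       ; (suc v , q) → cong (λ (w , r) → suc w , r) (strictlyInverseˡ (v , q)) })
    (λ { zero → refl ; (suc i) → cong suc (strictlyInverseʳ i) })
  go (no ¬p) = mk↔ₛ′
    (λ i → suc (proj₁ (to i)) , proj₂ (to i))
    (λ { (zero , q) → contradiction q ¬p ; (suc v , q) → from (v , q) })
    (λ { (zero , q) → contradiction q ¬p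
       ; (suc v , q) → cong (λ (w , r) → suc w , r) (strictlyInverseˡ (v , q)) })
    strictlyInverseʳ

infixl 6 _∖_
_∖_ : Pred (Fin n) 0ℓ → Fin n → Pred (Fin n) 0ℓ
(A ∖ a) z = A z × z ≢ a

∖-dec : Decidable A → ∀ a → Decidable (A ∖ a)
∖-dec A? a z = A? z ×-dec ¬? (z ≟ a)

count-∖ : (A? : Decidable A) → ∀ a → count A? ≤ suc (count (∖-dec A? a))
count-∖ A? a = begin
  count A?                                          ≤⟨ sum-mono split ⟩
  sum (λ z → ind (z ≟ a) + ind (∖-dec A? a z))      ≡⟨ ∑-distrib-+ (λ z → ind (z ≟ a)) _ ⟩
  count (_≟ a) + count (∖-dec A? a)                 ≡⟨ cong (_+ count (∖-dec A? a)) (count-singleton a) ⟩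
  suc (count (∖-dec A? a))                          ∎
  where
  open ≤-Reasoning
  split : ∀ z → ind (A? z) ≤ ind (z ≟ a) + ind (∖-dec A? a z)
  split z with A? z | z ≟ a
  ... | no _  | _     = z≤n
  ... | yes _ | yes _ = ≤-refl
  ... | yes _ | no _  = ≤-refl

pick : (A? : Decidable A) → suc m ≤ count A? → ∃ λ a → A a × m ≤ count (∖-dec A? a)
pick A? h with any? A?
... | yes (a , x) = a , x , ≤-pred (≤-trans h (count-∖ A? a))
... | no ¬x = contradiction (≤-trans h (≤-reflexive (count-none A? (λ z x → ¬x (z , x))))) λ ()

-- A is the set of available vertices; each edge makes its two ends unavailable.
data Matching {n} (E : Rel (Fin n) 0ℓ) (A : Pred (Fin n) 0ℓ) : ℕ → Set where
  []   : Matching E A 0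
  edge : ∀ {k a b} → a ≢ b → A a → A b → E a b → Matching E (A ∖ a ∖ b) k → Matching E A (suc k)

private variable
  E E′ : Rel (Fin n) 0ℓ

matching? : B.Decidable E → Decidable A → ∀ k → Dec (Matching E A k)
matching? E? A? zero = yes []
matching? E? A? (suc k) with any? (λ a → any? (λ b →
  ¬? (a ≟ b) ×-dec A? a ×-dec A? b ×-dec E? a b ×-dec matching? E? (∖-dec (∖-dec A? a) b) k))
... | yes (a , b , a≢b , x , y , e , μ) = yes (edge a≢b x y e μ)
... | no ¬μ = no λ { (edge a≢b x y e μ) → ¬μ (_ , _ , a≢b , x , y , e , μ) }

embed : (φ : Fin m → Fin n) → Injective _≡_ _≡_ φ →
  (∀ {a b} → E a b → E′ (φ a) (φ b)) → (∀ {z} → A z → B (φ z)) → Matching E A k → Matching E′ B k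
embed φ inj f g [] = []
embed φ inj f g (edge a≢b x y e μ) = edge (a≢b ∘ inj) (g x) (g y) (f e)
  (embed φ inj f (λ ((z , z≢a) , z≢b) → (g z , z≢a ∘ inj) , z≢b ∘ inj) μ)

matching-⊆ : A ⊆ B → Matching E A k → Matching E B k
matching-⊆ f = embed id id id f

matching-at : B.Symmetric E → Matching E A k → ∀ x →
  Matching E (A ∖ x) k ⊎
  ∃₂ λ y l → k ≡ suc l × A x × A y × y ≢ x × E x y × Matching E (A ∖ x ∖ y) l
matching-at E-sym [] x = inj₁ []
matching-at E-sym (edge {k} {a} {b} a≢b p q e μ) x with x ≟ a | x ≟ b
... | yes refl | _ = inj₂ (b , k , refl , p , q , a≢b ∘ sym , e , μ)
... | no _ | yes refl = inj₂ (a , k , refl , q , p , a≢b , E-sym e ,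
  matching-⊆ (λ ((z , z≢a) , z≢b) → (z , z≢b) , z≢a) μ)
... | no x≢a | no x≢b with matching-at E-sym μ x
...   | inj₁ ν = inj₁ (edge a≢b (p , x≢a ∘ sym) (q , x≢b ∘ sym) e
  (matching-⊆ (λ (((z , z≢a) , z≢b) , z≢x) → ((z , z≢x) , z≢a) , z≢b) ν))
...   | inj₂ (y , l , refl , ((r , _) , _) , ((s , y≢a) , y≢b) , y≢x , f , ν) =
  inj₂ (y , suc l , refl , r , s , y≢x , f ,
    edge a≢b ((p , x≢a ∘ sym) , y≢a ∘ sym) ((q , x≢b ∘ sym) , y≢b ∘ sym) e
      (matching-⊆ (λ ((((z , z≢a) , z≢b) , z≢x) , z≢y) → (((z , z≢x) , z≢y) , z≢a) , z≢b) ν))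

-- The transitivity step of Gallai's lemma, following the alternating path from v:
-- v is matched to x in the matching missing u and w, and x to y in the one missing v.
-- Deleting v and x reduces the claim for v to the claim for y, and adding xy to the
-- resulting matching returns to v; when y is u or w, adding xy stops the path.
exchange : B.Symmetric E → ∀ k {A : Pred (Fin n) 0ℓ} {u w} v → u ≢ w → ¬ Matching E A (suc k) →
  Matching E (A ∖ v) k → Matching E (A ∖ u ∖ w) k →
  Matching E (A ∖ v ∖ u) k ⊎ Matching E (A ∖ v ∖ w) k
exchange E-sym zero v u≢w max f g = inj₁ []
exchange E-sym (suc k) {u = u} {w} v u≢w max f g with v ≟ u | v ≟ w
... | yes refl | _ = inj₂ g
... | no _ | yes refl = inj₁ (matching-⊆ (λ ((z , z≢u) , z≢w) → (z , z≢w) , z≢u) g)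
... | no v≢u | no v≢w with matching-at E-sym g v
...   | inj₁ g′ = inj₁ (matching-⊆ (λ (((z , z≢u) , z≢w) , z≢v) → (z , z≢v) , z≢u) g′)
...   | inj₂ (x , .k , refl , ((Av , _) , _) , ((Ax , x≢u) , x≢w) , x≢v , vx , g′)
  with matching-at E-sym f x
...     | inj₁ f′ = contradiction (edge (x≢v ∘ sym) Av Ax vx f′) max
...     | inj₂ (y , .k , refl , _ , (Ay , y≢v) , y≢x , xy , f′) with y ≟ u | y ≟ w
...       | yes refl | _ = inj₂ (edge (y≢x ∘ sym) ((Ax , x≢v) , x≢w) ((Ay , y≢v) , u≢w) xy
  (matching-⊆ (λ ((((z , z≢u) , z≢w) , z≢v) , z≢x) → (((z , z≢v) , z≢w) , z≢x) , z≢u) g′))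
...       | no _ | yes refl = inj₁ (edge (y≢x ∘ sym) ((Ax , x≢v) , x≢u) ((Ay , y≢v) , u≢w ∘ sym) xy
  (matching-⊆ (λ ((((z , z≢u) , z≢w) , z≢v) , z≢x) → (((z , z≢v) , z≢u) , z≢x) , z≢w) g′))
...       | no y≢u | no y≢w
  with exchange E-sym k y u≢w (max ∘ edge (x≢v ∘ sym) Av Ax vx) f′
         (matching-⊆ (λ ((((z , z≢u) , z≢w) , z≢v) , z≢x) → (((z , z≢v) , z≢x) , z≢u) , z≢w) g′)
...         | inj₁ h = inj₁ (edge (y≢x ∘ sym) ((Ax , x≢v) , x≢u) ((Ay , y≢v) , y≢u) xy
  (matching-⊆ (λ ((((z , z≢v) , z≢x) , z≢y) , z≢u) → (((z , z≢v) , z≢u) , z≢x) , z≢y) h))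
...         | inj₂ h = inj₂ (edge (y≢x ∘ sym) ((Ax , x≢v) , x≢w) ((Ay , y≢v) , y≢w) xy
  (matching-⊆ (λ ((((z , z≢v) , z≢x) , z≢y) , z≢w) → (((z , z≢v) , z≢w) , z≢x) , z≢y) h))

covered : Matching E A k → Σ (Pred (Fin n) 0ℓ) λ C → Σ (Decidable C) λ C? →
  C ⊆ A × count C? ≤ 2 * k × Matching E C k
covered {n = n} [] = (λ _ → ⊥) , (λ _ → no λ ()) , (λ ()) , ≤-reflexive (count-none {n} {P = λ _ → ⊥} (λ _ → no λ ()) λ _ ()) , []
covered {A = A} (edge {k} {a} {b} a≢b x y e μ) with covered μ
... | C , C? , C⊆ , |C|≤ , ν = D , D? , D⊆A , |D|≤ , edge a≢b (inj₁ refl) (inj₂ (inj₁ refl)) e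
  (matching-⊆ (λ c → (inj₂ (inj₂ c) , proj₂ (proj₁ (C⊆ c))) , proj₂ (C⊆ c)) ν)
  where
  D : Pred _ 0ℓ
  D z = z ≡ a ⊎ z ≡ b ⊎ C z
  D? : Decidable D
  D? z = z ≟ a ⊎-dec z ≟ b ⊎-dec C? z
  D⊆A : D ⊆ A
  D⊆A (inj₁ refl) = x
  D⊆A (inj₂ (inj₁ refl)) = y
  D⊆A (inj₂ (inj₂ c)) = proj₁ (proj₁ (C⊆ c))
  split : ∀ z → ind (D? z) ≤ ind (z ≟ a) + (ind (z ≟ b) + ind (C? z))
  split z with z ≟ a | z ≟ b | C? z
  ... | yes _ | _     | _     = s≤s z≤n
  ... | no _  | yes _ | _     = s≤s z≤n
  ... | no _  | no _  | yes _ = s≤s z≤n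
  ... | no _  | no _  | no _  = z≤n
  open ≤-Reasoning
  |D|≤ : count D? ≤ 2 * suc k
  |D|≤ = begin
    count D?                                                   ≤⟨ sum-mono split ⟩
    sum (λ z → ind (z ≟ a) + (ind (z ≟ b) + ind (C? z)))       ≡⟨ ∑-distrib-+ (λ z → ind (z ≟ a)) _ ⟩
    count (_≟ a) + sum (λ z → ind (z ≟ b) + ind (C? z))
      ≡⟨ cong₂ _+_ (count-singleton a) (trans (∑-distrib-+ (λ z → ind (z ≟ b)) _) (cong (_+ count C?) (count-singleton b))) ⟩
    2 + count C?                                               ≤⟨ +-monoʳ-≤ 2 |C|≤ ⟩
    2 + 2 * k                                                  ≡⟨ sym (*-suc 2 k) ⟩
    2 * suc k                                                  ∎

pairs-≤ : (g : Fin n → Fin n → ℕ) → (∀ u v → v ≢ u → 1 ≤ g u v) → n * n ≤ n + sum λ u → sum (g u)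
pairs-≤ {n} g h = begin
  n * n                              ≡⟨ sum-const n n ⟨
  sum {n} (λ _ → n)                  ≤⟨ sum-mono row ⟩
  sum (λ u → 1 + sum (g u))          ≡⟨ ∑-distrib-+ {n} (λ _ → 1) (λ u → sum (g u)) ⟩
  sum {n} (λ _ → 1) + sum (λ u → sum (g u))
    ≡⟨ cong (_+ sum (λ u → sum (g u))) (trans (sum-const n 1) (*-identityʳ n)) ⟩
  n + sum (λ u → sum (g u))          ∎
  where
  open ≤-Reasoning
  row : ∀ u → n ≤ 1 + sum (g u)
  row u = begin
    n                                ≡⟨ trans (sum-const n 1) (*-identityʳ n) ⟨
    sum {n} (λ _ → 1)                ≤⟨ sum-mono entry ⟩
    sum (λ v → ind (v ≟ u) + g u v)  ≡⟨ ∑-distrib-+ (λ v → ind (v ≟ u)) (g u) ⟩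
    count (_≟ u) + sum (g u)         ≡⟨ cong (_+ sum (g u)) (count-singleton u) ⟩
    1 + sum (g u)                    ∎
    where
    entry : ∀ v → 1 ≤ ind (v ≟ u) + g u v
    entry v with v ≟ u
    ... | yes _  = s≤s z≤n
    ... | no v≢u = h u v v≢u

-- Complements of decidable equivalence relations, the constructively convenient form here.
record Apartness (_#_ : Rel (Fin n) 0ℓ) : Set where
  field
    #-dec     : B.Decidable _#_
    #-sym     : B.Symmetric _#_
    #-cotrans : ∀ {u w} → u # w → ∀ v → v # u ⊎ v # w

  linked? : ∀ u v → Dec (v ≢ u × ¬ u # v)
  linked? u v = ¬? (v ≟ u) ×-dec ¬? (#-dec u v)

  links : ℕ
  links = sum λ u → count (linked? u)

  -- A misses at most one vertex of each class: ordered linked pairs inside A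
  -- number at most c² − c, and each vertex of A is linked to at most one vertex outside.
  links-≤ : (C? : Decidable A) → (∀ {u v} → ¬ A u → ¬ A v → u ≢ v → u # v) →
    links ≤ count C? * count C? + count C?
  links-≤ C? apart = +-cancelʳ-≤ c _ _ (begin
    links + c
      ≡⟨ cong (links +_) (sum-cong-≗ λ u → trans (sym (*-identityʳ (x u)))
           (trans (cong (x u *_) (sym (count-singleton u))) (*-distribˡ-sum (x u) (λ v → ind (v ≟ u))))) ⟩
    links + sum (λ u → sum λ v → x u * ind (v ≟ u))
      ≡⟨ ∑-distrib-+ (λ u → count (linked? u)) _ ⟨
    sum (λ u → count (linked? u) + sum λ v → x u * ind (v ≟ u))
      ≡⟨ (sum-cong-≗ λ u → sym (∑-distrib-+ (λ v → ind (linked? u v)) _)) ⟩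
    sum (λ u → sum λ v → ind (linked? u v) + x u * ind (v ≟ u))
      ≤⟨ (sum-mono λ u → sum-mono λ v → entry u v) ⟩
    sum (λ u → sum λ v → x u * x v + (y u v + y v u))
      ≡⟨ (sum-cong-≗ λ u → trans (∑-distrib-+ (λ v → x u * x v) (λ v → y u v + y v u))
           (cong₂ _+_ (sym (*-distribˡ-sum (x u) x)) (∑-distrib-+ (y u) (λ v → y v u)))) ⟩
    sum (λ u → x u * c + (sum (y u) + sum (λ v → y v u)))
      ≡⟨ trans (∑-distrib-+ (λ u → x u * c) _)
           (cong₂ _+_ (sym (*-distribʳ-sum c x)) (∑-distrib-+ (λ u → sum (y u)) _)) ⟩
    c * c + (sum (λ u → sum (y u)) + sum (λ u → sum (λ v → y v u)))
      ≡⟨ cong (λ z → c * c + (sum (λ u → sum (y u)) + z)) (∑-comm (λ u v → y v u)) ⟩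
    c * c + (sum (λ u → sum (y u)) + sum (λ u → sum (y u)))
      ≤⟨ +-monoʳ-≤ (c * c) (+-mono-≤ (sum-mono row) (sum-mono row)) ⟩
    c * c + (c + c)
      ≡⟨ sym (+-assoc (c * c) c c) ⟩
    c * c + c + c ∎)
    where
    open ≤-Reasoning
    c = count C?
    x : Fin n → ℕ
    x u = ind (C? u)
    y? : ∀ u v → Dec (_ × _ × _)
    y? u v = C? u ×-dec ¬? (C? v) ×-dec ¬? (#-dec u v)
    y : Fin n → Fin n → ℕ
    y u v = ind (y? u v)
    row : ∀ u → sum (y u) ≤ x u
    row u = count-subsingleton (y? u) (C? u) (λ _ → proj₁) unique
      where
      unique : ∀ {v w} → _ → _ → v ≡ w
      unique {v} {w} (_ , v∉ , ¬uv) (_ , w∉ , ¬uw) with v ≟ w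
      ... | yes v≡w = v≡w
      ... | no v≢w with #-cotrans (apart v∉ w∉ v≢w) u
      ...   | inj₁ uv = contradiction uv ¬uv
      ...   | inj₂ uw = contradiction uw ¬uw
    entry : ∀ u v → ind (linked? u v) + x u * ind (v ≟ u) ≤ x u * x v + (y u v + y v u)
    entry u v with v ≟ u
    entry u v | yes refl with C? u
    ... | yes _ = s≤s z≤n
    ... | no _ = z≤n
    entry u v | no v≢u with C? u | C? v | #-dec u v | #-dec v u
    ... | yes _ | yes _ | no _   | _     = s≤s z≤n
    ... | yes _ | yes _ | yes _  | _     = z≤n
    ... | yes _ | no _  | no _   | _     = s≤s z≤n
    ... | yes _ | no _  | yes _  | _     = z≤n
    ... | no _  | yes _ | no _   | no _  = s≤s z≤n
    ... | no _  | yes _ | no ¬uv | yes q = contradiction (#-sym q) ¬uv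
    ... | no _  | yes _ | yes _  | _     = z≤n
    ... | no _  | no _  | yes _  | _     = z≤n
    ... | no p  | no q  | no ¬uv | _     = contradiction (apart p q (v≢u ∘ sym)) ¬uv

module _ {_#_ _♯_ : Rel (Fin n) 0ℓ} (P : Apartness _#_) (Q : Apartness _♯_)
         (disjoint : ∀ {u v} → u # v → ¬ u ♯ v) where
  private
    module P = Apartness P
    module Q = Apartness Q

  disjoint-apartness-path : ∀ {a b c} → a # b → ¬ a ♯ c
  disjoint-apartness-path {a} {b} {c} a#b a♯c with P.#-cotrans a#b c | Q.#-cotrans a♯c b
  ... | inj₁ c#a | _        = disjoint (P.#-sym c#a) a♯c
  ... | inj₂ _   | inj₁ b♯a = disjoint a#b (Q.#-sym b♯a)
  ... | inj₂ c#b | inj₂ b♯c = disjoint c#b (Q.#-sym b♯c)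

  disjoint-apartness : ∀ {a b c d} → a # b → ¬ c ♯ d
  disjoint-apartness {a} a#b c♯d with Q.#-cotrans c♯d a
  ... | inj₁ a♯c = disjoint-apartness-path a#b a♯c
  ... | inj₂ a♯d = disjoint-apartness-path a#b a♯d

module Inessential {E : Rel (Fin n) 0ℓ} (E? : B.Decidable E) (E-sym : B.Symmetric E) {k}
    (maximum : ¬ Matching E U (suc k)) (inessential : ∀ v → Matching E (U ∖ v) k) where

  _#_ : Rel (Fin n) 0ℓ
  u # w = u ≢ w × Matching E (U ∖ u ∖ w) k

  apartness : Apartness _#_
  apartness = record
    { #-dec = λ u w → ¬? (u ≟ w) ×-dec matching? E? (∖-dec (∖-dec (λ _ → yes _) u) w) k
    ; #-sym = #-sym
    ; #-cotrans = #-cotrans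
    }
    where
    #-sym : B.Symmetric _#_
    #-sym (u≢w , μ) = u≢w ∘ sym , matching-⊆ (λ ((z , z≢u) , z≢w) → (z , z≢w) , z≢u) μ
    #-cotrans : ∀ {u w} → u # w → ∀ v → v # u ⊎ v # w
    #-cotrans {u} {w} (u≢w , μ) v with v ≟ u | v ≟ w
    ... | yes refl | _ = inj₂ (u≢w , μ)
    ... | no v≢u | yes refl = inj₁ (#-sym (u≢w , μ))
    ... | no v≢u | no v≢w with exchange E-sym k v u≢w maximum (inessential v) μ
    ...   | inj₁ ν = inj₁ (v≢u , ν)
    ...   | inj₂ ν = inj₂ (v≢w , ν)

  open Apartness apartness public

  edge-linked : ∀ {u v} → E u v → ¬ u # v
  edge-linked uv (u≢v , μ) = maximum (edge u≢v _ _ uv μ)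

  links-bound : Matching E U k → links ≤ 2 * k * (2 * k) + 2 * k
  links-bound μ with covered μ
  ... | C , C? , _ , |C|≤ , ν = ≤-trans
    (links-≤ C? λ u∉ v∉ u≢v → u≢v , matching-⊆ (λ c → (_ , λ { refl → u∉ c }) , λ { refl → v∉ c }) ν)
    (+-mono-≤ (*-mono-≤ |C|≤ |C|≤) |C|≤)

  ∃-apart : Matching E U k → n + (2 * k * (2 * k) + 2 * k) < n * n → ∃₂ _#_
  ∃-apart μ h with any? (λ u → any? (λ v → #-dec u v))
  ... | yes uv = uv
  ... | no none = contradiction (≤-trans (pairs-≤ (λ u v → ind (linked? u v)) linked)
                    (+-monoʳ-≤ n (links-bound μ))) (<⇒≱ h)
    where
    linked : ∀ u v → v ≢ u → 1 ≤ ind (linked? u v)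
    linked u v v≢u = ≤-reflexive (sym (ind-yes (linked? u v) (v≢u , λ q → none (u , v , q))))

clear : Fin n → (Fin n → ℕ) → Fin n → ℕ
clear i f j = if does (j ≟ i) then 0 else f j

clear-other : ∀ (f : Fin n → ℕ) {i j} → j ≢ i → clear i f j ≡ f j
clear-other f {i} {j} j≢i with j ≟ i
... | yes j≡i = contradiction j≡i j≢i
... | no _ = refl

sum-clear : ∀ (f : Fin n → ℕ) i → sum f ≡ f i + sum (clear i f)
sum-clear f i = begin
  sum f                                                ≡⟨ sum-cong-≗ split ⟩
  sum (λ j → f i * ind (j ≟ i) + clear i f j)          ≡⟨ ∑-distrib-+ (λ j → f i * ind (j ≟ i)) (clear i f) ⟩
  sum (λ j → f i * ind (j ≟ i)) + sum (clear i f)      ≡⟨ cong (_+ sum (clear i f)) (*-distribˡ-sum (f i) (λ j → ind (j ≟ i))) ⟨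
  f i * count (_≟ i) + sum (clear i f)                 ≡⟨ cong (λ x → f i * x + sum (clear i f)) (count-singleton i) ⟩
  f i * 1 + sum (clear i f)                            ≡⟨ cong (_+ sum (clear i f)) (*-identityʳ (f i)) ⟩
  f i + sum (clear i f)                                ∎
  where
  open ≡-Reasoning
  split : ∀ j → f j ≡ f i * ind (j ≟ i) + clear i f j
  split j with j ≟ i
  ... | yes refl = sym (trans (+-identityʳ (f j * 1)) (*-identityʳ (f j)))
  ... | no _ = cong (_+ f j) (sym (*-zeroʳ (f i)))

sum≡0⇒≡0 : (f : Fin n → ℕ) → sum f ≡ 0 → ∀ i → f i ≡ 0
sum≡0⇒≡0 f h i = n≤0⇒n≡0 (≤-trans (≤-sum f i) (≤-reflexive h))

sum-positive : (f : Fin n → ℕ) → 1 ≤ sum f → ∃ λ i → 1 ≤ f i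
sum-positive f h with any? (λ i → 1 ≤? f i)
... | yes p = p
... | no ¬p = contradiction (≤-trans h (≤-reflexive (sum-zero λ i → n<1⇒n≡0 (≰⇒> (λ q → ¬p (i , q)))))) λ ()

m+n≤m⇒n≡0 : ∀ m {n} → m + n ≤ m → n ≡ 0
m+n≤m⇒n≡0 m {n} h = n≤0⇒n≡0 (+-cancelˡ-≤ m n 0 (≤-trans h (≤-reflexive (sym (+-identityʳ m)))))

-- With S = M + d or M = S + d, the two sides differ by an explicit sum of terms
-- that all have to vanish.
critical-sizes : ∀ {S M D n} → S + M + 1 ≤ n → n * n + 4 * D ≤ n + (4 * M + 2) * S →
  n ≡ S + M + 1 × D ≡ 0 × (S ≡ M ⊎ S ≡ suc M)
critical-sizes {S} {M} {D} S+M<n bound with m≤n⇒∃[o]m+o≡n S+M<n | S ≤? M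
critical-sizes {S} {M} {D} S+M<n bound | e , refl | yes S≤M with m≤n⇒∃[o]m+o≡n S≤M
... | d , refl =
  trans (cong (S + (S + d) + 1 +_) (m+n≡0⇒n≡0 d d+e≡0)) (+-identityʳ _) ,
  m+n≡0⇒m≡0 D (m+n≡0⇒n≡0 ((d + e) * (1 + (d + e))) residue) ,
  inj₁ (sym (trans (cong (S +_) (m+n≡0⇒m≡0 d d+e≡0)) (+-identityʳ S)))
  where
  identity : ∀ S d e D → (S + (S + d) + 1 + e) * (S + (S + d) + 1 + e) + 4 * D ≡
    ((S + (S + d) + 1 + e) + (4 * (S + d) + 2) * S) + (4 * S * e + ((d + e) * (1 + (d + e)) + 4 * D))
  identity = solve-∀
  residue : (d + e) * (1 + (d + e)) + 4 * D ≡ 0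
  residue = m+n≡0⇒n≡0 (4 * S * e) (m+n≤m⇒n≡0 ((S + (S + d) + 1 + e) + (4 * (S + d) + 2) * S)
    (≤-trans (≤-reflexive (sym (identity S d e D))) bound))
  d+e≡0 : d + e ≡ 0
  d+e≡0 = m*n≡0⇒m≡0 (d + e) (1 + (d + e)) (m+n≡0⇒m≡0 ((d + e) * (1 + (d + e))) residue)
critical-sizes {S} {M} {D} S+M<n bound | e , refl | no S≰M with m≤n⇒∃[o]m+o≡n (≰⇒> S≰M)
... | d , refl =
  trans (cong (1 + M + d + M + 1 +_) (m+n≡0⇒m≡0 e (m+n≡0⇒m≡0 (3 * e) residue′))) (+-identityʳ _) ,
  m+n≡0⇒m≡0 D (m+n≡0⇒n≡0 ((d + e) * (d + e)) (m+n≡0⇒n≡0 (3 * e) residue′)) ,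
  inj₂ (trans (cong (1 + M +_) (m+n≡0⇒m≡0 d residue)) (+-identityʳ _))
  where
  identity : ∀ M d e D → (1 + M + d + M + 1 + e) * (1 + M + d + M + 1 + e) + 4 * D + 2 * (1 + d) ≡
    (1 + M + d + M + 1 + e) + (4 * M + 2) * (1 + M + d)
      + (4 * M * e + (d + (3 * e + ((d + e) * (d + e) + 4 * D)))) + 2 * (1 + d)
  identity = solve-∀
  residue : d + (3 * e + ((d + e) * (d + e) + 4 * D)) ≡ 0
  residue = m+n≡0⇒n≡0 (4 * M * e)
    (m+n≤m⇒n≡0 ((1 + M + d + M + 1 + e) + (4 * M + 2) * (1 + M + d))
      (≤-trans (≤-reflexive (sym (+-cancelʳ-≡ (2 * (1 + d)) _ _ (identity M d e D)))) bound))
  residue′ : 3 * e + ((d + e) * (d + e) + 4 * D) ≡ 0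
  residue′ = m+n≡0⇒n≡0 d residue

Colored : ∀ {c} → Coloring n c → Fin c → Rel (Fin n) 0ℓ
Colored col i u v = col u v ≡ i

module Critical {n c} (col : Coloring n c) (col-sym : Symmetric col) (k : Fin c → ℕ) (M : ℕ)
    (k≤M : ∀ i → k i ≤ M) (large : sum k + M + 1 ≤ n)
    (maximum : ∀ i → ¬ Matching (Colored col i) U (suc (k i)))
    (inessential : ∀ i v → Matching (Colored col i) (U ∖ v) (k i)) where

  vertex : Fin n
  vertex = F.fromℕ< (≤-trans (m≤n+m 1 (sum k + M)) large)

  module Color i = Inessential {E = Colored col i} (λ u v → col u v ≟ i)
    (λ {u} {v} e → trans (col-sym v u) e) (maximum i) (inessential i)

  max-matching : ∀ i → Matching (Colored col i) U (k i)
  max-matching i = matching-⊆ (λ _ → _) (inessential i vertex)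

  deficit : ℕ
  deficit = sum λ i → k i * (M ∸ k i)

  link-count : n * n + 4 * deficit ≤ n + (4 * M + 2) * sum k
  link-count = begin
    n * n + 4 * deficit
      ≤⟨ +-monoˡ-≤ (4 * deficit) (pairs-≤ (λ u v → sum λ i → ind (Color.linked? i u v)) linked) ⟩
    n + sum (λ u → sum λ v → sum λ i → ind (Color.linked? i u v)) + 4 * deficit
      ≡⟨ cong (λ x → n + x + 4 * deficit)
           (trans (sum-cong-≗ λ u → ∑-comm (λ v i → ind (Color.linked? i u v)))
             (∑-comm (λ u i → sum λ v → ind (Color.linked? i u v)))) ⟩
    n + sum (λ i → Color.links i) + 4 * deficit
      ≤⟨ +-monoˡ-≤ (4 * deficit) (+-monoʳ-≤ n (sum-mono λ i → Color.links-bound i (max-matching i))) ⟩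
    n + sum (λ i → 2 * k i * (2 * k i) + 2 * k i) + 4 * deficit
      ≡⟨ +-assoc n _ _ ⟩
    n + (sum (λ i → 2 * k i * (2 * k i) + 2 * k i) + 4 * deficit)
      ≡⟨ cong (λ x → n + (sum (λ i → 2 * k i * (2 * k i) + 2 * k i) + x))
           (*-distribˡ-sum 4 (λ i → k i * (M ∸ k i))) ⟩
    n + (sum (λ i → 2 * k i * (2 * k i) + 2 * k i) + sum (λ i → 4 * (k i * (M ∸ k i))))
      ≡⟨ cong (n +_) (∑-distrib-+ (λ i → 2 * k i * (2 * k i) + 2 * k i) (λ i → 4 * (k i * (M ∸ k i)))) ⟨
    n + sum (λ i → 2 * k i * (2 * k i) + 2 * k i + 4 * (k i * (M ∸ k i)))
      ≡⟨ cong (n +_) (sum-cong-≗ λ i → trans (identity (k i) (M ∸ k i))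
           (cong (λ x → (4 * x + 2) * k i) (m+[n∸m]≡n (k≤M i)))) ⟩
    n + sum (λ i → (4 * M + 2) * k i)
      ≡⟨ cong (n +_) (*-distribˡ-sum (4 * M + 2) k) ⟨
    n + (4 * M + 2) * sum k ∎
    where
    open ≤-Reasoning
    identity : ∀ a b → 2 * a * (2 * a) + 2 * a + 4 * (a * b) ≡ (4 * (a + b) + 2) * a
    identity = solve-∀
    linked : ∀ u v → v ≢ u → 1 ≤ sum λ i → ind (Color.linked? i u v)
    linked u v v≢u = ≤-trans
      (≤-reflexive (sym (ind-yes (Color.linked? i u v) (v≢u , Color.edge-linked i refl))))
      (≤-sum (λ i → ind (Color.linked? i u v)) i)
      where i = col u v

  sizes : n ≡ sum k + M + 1 × deficit ≡ 0 × (sum k ≡ M ⊎ sum k ≡ suc M)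
  sizes = critical-sizes large link-count

  positive⇒M : ∀ {i} → 1 ≤ k i → k i ≡ M
  positive⇒M {i} 1≤k with m*n≡0⇒m≡0∨n≡0 (k i) (sum≡0⇒≡0 (λ i → k i * (M ∸ k i)) (proj₁ (proj₂ sizes)) i)
  ... | inj₁ k≡0 = contradiction (≤-trans 1≤k (≤-reflexive k≡0)) λ ()
  ... | inj₂ M∸k≡0 = ≤-antisym (k≤M i) (m∸n≡0⇒m≤n M∸k≡0)

  no-two-colors : ∀ i j → n ≡ 4 → k i ≡ 1 → k j ≡ 1 → (∀ l → l ≢ i → l ≢ j → k l ≡ 0) → ⊥
  no-two-colors i j n≡4 ki≡1 kj≡1 rest =
    disjoint-apartness (Color.apartness i) (Color.apartness j) disjoint
      (proj₂ (proj₂ (apart ki≡1))) (proj₂ (proj₂ (apart kj≡1)))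
    where
    apart : ∀ {l} → k l ≡ 1 → ∃₂ (Color._#_ l)
    apart {l} kl≡1 = Color.∃-apart l (max-matching l) bound
      where
      bound : n + (2 * k l * (2 * k l) + 2 * k l) < n * n
      bound rewrite n≡4 | kl≡1 = m≤m+n 11 5
    disjoint : ∀ {u v} → Color._#_ i u v → ¬ Color._#_ j u v
    disjoint {u} {v} p q with col u v ≟ i | col u v ≟ j
    ... | yes e | _     = Color.edge-linked i e p
    ... | no _  | yes e = Color.edge-linked j e q
    ... | no ≢i | no ≢j = maximum (col u v) (subst (λ x → Matching (Colored col (col u v)) U (suc x))
      (sym (rest (col u v) ≢i ≢j)) (edge (proj₁ p) _ _ refl []))

  none-positive : ¬ ∃ (λ i → 1 ≤ k i) → ∀ i → k i ≡ 0
  none-positive none i = n<1⇒n≡0 (≰⇒> λ p → none (i , p))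

  one-color : ∃ λ i → k i ≡ M × ∀ j → j ≢ i → k j ≡ 0
  one-color with any? (λ i → 1 ≤? k i) | proj₂ (proj₂ sizes)
  ... | no none | inj₂ S≡1+M =
    contradiction (trans (sym S≡1+M) (sum-zero (none-positive none))) λ ()
  ... | no none | inj₁ S≡M = col vertex vertex ,
    trans (none-positive none _) (trans (sym (sum-zero (none-positive none))) S≡M) ,
    λ j _ → none-positive none j
  ... | yes (i , 1≤ki) | inj₁ S≡M = i , positive⇒M 1≤ki , others
    where
    others : ∀ j → j ≢ i → k j ≡ 0
    others j j≢i = trans (sym (clear-other k j≢i)) (sum≡0⇒≡0 (clear i k)
      (m+n≤m⇒n≡0 M (≤-reflexive (trans (cong (_+ sum (clear i k)) (sym (positive⇒M 1≤ki)))
        (trans (sym (sum-clear k i)) S≡M)))) j)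
  ... | yes (i , 1≤ki) | inj₂ S≡1+M =
    ⊥-elim (two-colors (sum-positive (clear i k) (≤-reflexive (sym rest≡1))))
    where
    rest≡1 : sum (clear i k) ≡ 1
    rest≡1 = +-cancelˡ-≡ M _ _ (trans (cong (_+ sum (clear i k)) (sym (positive⇒M 1≤ki)))
      (trans (sym (sum-clear k i)) (trans S≡1+M (+-comm 1 M))))
    two-colors : ∃ (λ j → 1 ≤ clear i k j) → ⊥
    two-colors (j , 1≤cj) with j ≟ i
    ... | no j≢i = no-two-colors i j
        (trans (proj₁ sizes) (cong₂ (λ x y → x + y + 1) (trans S≡1+M (cong suc M≡1)) M≡1))
        (trans (positive⇒M 1≤ki) M≡1) (trans (positive⇒M 1≤cj) M≡1) others
      where
      g : Fin c → ℕ
      g = clear i k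
      gj≡kj : g j ≡ k j
      gj≡kj = clear-other k j≢i
      split : k j + sum (clear j g) ≡ 1
      split = trans (cong (_+ sum (clear j g)) (sym gj≡kj)) (trans (sym (sum-clear g j)) rest≡1)
      kj≡1 : k j ≡ 1
      kj≡1 = ≤-antisym (≤-trans (m≤m+n (k j) _) (≤-reflexive split)) 1≤cj
      M≡1 : M ≡ 1
      M≡1 = trans (sym (positive⇒M 1≤cj)) kj≡1
      others : ∀ l → l ≢ i → l ≢ j → k l ≡ 0
      others l l≢i l≢j = trans (sym (trans (clear-other g l≢j) (clear-other k l≢i)))
        (sum≡0⇒≡0 (clear j g) (m+n≤m⇒n≡0 1 (≤-reflexive (trans (cong (_+ sum (clear j g)) (sym kj≡1)) split))) l)

clique-matching : (A? : Decidable A) → (∀ {a b} → A a → A b → a ≢ b → E a b) →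
  ∀ k → 2 * k ≤ count A? → Matching E A k
clique-matching A? h zero le = []
clique-matching A? h (suc k) le with pick A? (≤-trans (≤-reflexive (sym (*-suc 2 k))) le)
... | a , x , le₁ with pick (∖-dec A? a) le₁
...   | b , (y , b≢a) , le₂ = edge (b≢a ∘ sym) x y (h x y (b≢a ∘ sym))
  (clique-matching (∖-dec (∖-dec A? a) b) (λ ((p , _) , _) ((q , _) , _) → h p q) k le₂)

bipartite-matching : (A? : Decidable A) (B? : Decidable B) → (∀ {a b} → A a → B b → a ≢ b × E a b) →
  ∀ k → k ≤ count A? → k ≤ count B? → Matching E (A ∪ B) k
bipartite-matching A? B? h zero _ _ = []
bipartite-matching A? B? h (suc k) le₁ le₂ with pick A? le₁ | pick B? le₂
... | a , x , le₁′ | b , y , le₂′ = edge (proj₁ (h x y)) (inj₁ x) (inj₂ y) (proj₂ (h x y))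
  (matching-⊆ (λ { (inj₁ (p , z≢a)) → (inj₁ p , z≢a) , proj₁ (h p y)
                 ; (inj₂ (q , z≢b)) → (inj₂ q , proj₁ (h x q) ∘ sym) , z≢b })
    (bipartite-matching (∖-dec A? a) (∖-dec B? b) (λ (p , _) (q , _) → h p q) k le₁′ le₂′))

record Structure {n c} (col : Coloring n c) (k : Fin c → ℕ) (M : ℕ) : Set where
  field
    centre       : Fin c
    part         : Fin n → Fin c
    k-centre     : k centre ≡ M
    count-centre : count (λ v → part v ≟ centre) ≡ suc (2 * M)
    count-other  : ∀ j → j ≢ centre → count (λ v → part v ≟ j) ≡ k j
    inside       : ∀ {u v} → u ≢ v → part u ≡ part v → col u v ≡ part u
    to-centre    : ∀ {u v} → part u ≡ centre → part v ≢ centre → col u v ≡ part v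
    across       : ∀ {u v} → part u ≢ centre → part v ≢ centre → part u ≢ part v →
                   col u v ≡ part u ⊎ col u v ≡ part v

  centre-∖ : ∀ u → 2 * M ≤ count (∖-dec (λ v → part v ≟ centre) u)
  centre-∖ u = ≤-pred (≤-trans (≤-reflexive (sym count-centre)) (count-∖ (λ v → part v ≟ centre) u))

  centre-matching : ∀ u → Matching (Colored col centre) (U ∖ u) M
  centre-matching u = matching-⊆ (λ (_ , z≢u) → _ , z≢u)
    (clique-matching (∖-dec (λ v → part v ≟ centre) u)
      (λ (p , _) (q , _) a≢b → trans (inside a≢b (trans p (sym q))) p) M (centre-∖ u))

  side-matching : Symmetric col → ∀ {j} u → j ≢ centre → part u ≢ j → k j ≤ M →
    Matching (Colored col j) (U ∖ u) (k j)
  side-matching col-sym {j} u j≢centre u∉j kj≤M = matching-⊆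
    (λ { (inj₁ p) → _ , λ { refl → u∉j p } ; (inj₂ (_ , z≢u)) → _ , z≢u })
    (bipartite-matching (λ v → part v ≟ j) (∖-dec (λ v → part v ≟ centre) u)
      (λ p (q , _) → (λ { refl → j≢centre (trans (sym p) q) }) ,
        trans (col-sym _ _) (trans (to-centre q (j≢centre ∘ trans (sym p))) p))
      (k j) (≤-reflexive (sym (count-other j j≢centre)))
      (≤-trans kj≤M (≤-trans (m≤m+n M _) (centre-∖ u))))

delete : ∀ {c} → Fin (suc n) → Coloring (suc n) c → Coloring n c
delete v col u w = col (punchIn v u) (punchIn v w)

restore : ∀ {c} {col : Coloring (suc n) c} {i} v → A ⊆ (λ u → B (punchIn v u)) →
  Matching (Colored (delete v col) i) A k → Matching (Colored col i) B k
restore v A⊆B = embed (punchIn v) (λ {a} {b} → punchIn-injective v a b) id A⊆B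

lower : Fin n → (Fin n → ℕ) → Fin n → ℕ
lower i k j = k j ∸ ind (j ≟ i)

lower-other : ∀ (k : Fin n → ℕ) {i j} → j ≢ i → lower i k j ≡ k j
lower-other k {i} {j} j≢i = cong (k j ∸_) (ind-no (j ≟ i) j≢i)

suc-lower : ∀ (k : Fin n → ℕ) {i} → 1 ≤ k i → suc (lower i k i) ≡ k i
suc-lower k {i} 1≤k = trans (cong (λ x → suc (k i ∸ x)) (ind-yes (i ≟ i) refl)) (m+[n∸m]≡n 1≤k)

sum-lower : ∀ (k : Fin n → ℕ) {i} → 1 ≤ k i → suc (sum (lower i k)) ≡ sum k
sum-lower k {i} 1≤k = begin
  1 + sum (lower i k)                           ≡⟨ cong (_+ sum (lower i k)) (count-singleton i) ⟨
  count (_≟ i) + sum (lower i k)                ≡⟨ ∑-distrib-+ (λ j → ind (j ≟ i)) (lower i k) ⟨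
  sum (λ j → ind (j ≟ i) + lower i k j)         ≡⟨ sum-cong-≗ entry ⟩
  sum k                                         ∎
  where
  open ≡-Reasoning
  entry : ∀ j → ind (j ≟ i) + lower i k j ≡ k j
  entry j with j ≟ i
  ... | yes refl = m+[n∸m]≡n 1≤k
  ... | no _     = refl

data Punched (v : Fin (suc n)) : Fin (suc n) → Set where
  here  : Punched v v
  there : ∀ u → Punched v (punchIn v u)

punched : (v w : Fin (suc n)) → Punched v w
punched v w with v ≟ w
... | yes refl = here
... | no v≢w = subst (Punched v) (punchIn-punchOut v≢w) (there (punchOut v≢w))

module Extend {n c} (col : Coloring (suc n) c) (col-sym : Symmetric col) (k : Fin c → ℕ) (M : ℕ)
    (k≤M : ∀ i → k i ≤ M) (maximum : ∀ i → ¬ Matching (Colored col i) U (suc (k i)))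
    (i : Fin c) (v : Fin (suc n)) (1≤ki : 1 ≤ k i) (S : Structure (delete v col) (lower i k) M) where

  open Structure S

  i≢centre : i ≢ centre
  i≢centre refl = contradiction (≤-trans (≤-reflexive (trans (cong suc (sym k-centre)) (suc-lower k 1≤ki))) (k≤M i)) (<⇒≱ ≤-refl)

  lower-≤ : ∀ j → lower i k j ≤ M
  lower-≤ j = ≤-trans (m∸n≤m (k j) (ind (j ≟ i))) (k≤M j)

  add-edge : ∀ {j} u → col v (punchIn v u) ≡ j → ¬ Matching (Colored (delete v col) j) (U ∖ u) (k j)
  add-edge {j} u e μ = maximum j (edge (punchInᵢ≢i v u ∘ sym) _ _ e
    (restore v (λ (_ , z≢u) → (_ , punchInᵢ≢i v _) , z≢u ∘ punchIn-injective v _ _) μ))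

  color-at-v : ∀ u → col v (punchIn v u) ≡ i ⊎ (col v (punchIn v u) ≡ part u × part u ≢ centre)
  color-at-v u with col v (punchIn v u) ≟ i | col v (punchIn v u) ≟ centre | part u ≟ col v (punchIn v u)
  ... | yes e | _ | _ = inj₁ e
  ... | no _ | yes e | _ = contradiction
    (subst (Matching _ _) (sym (trans (sym (lower-other k (i≢centre ∘ sym))) k-centre)) (centre-matching u))
    (add-edge u e)
  ... | no _ | no ≢centre | yes e = inj₂ (sym e , ≢centre ∘ trans (sym e))
  ... | no ≢i | no ≢centre | no u∉ = contradiction
    (subst (Matching _ _) (lower-other k {i} {col v (punchIn v u)} ≢i)
      (side-matching (λ a b → col-sym _ _) u ≢centre u∉ (lower-≤ (col v (punchIn v u)))))
    (add-edge u refl)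

  part′ : Fin (suc n) → Fin c
  part′ = insertAt part v i

  part′-v : part′ v ≡ i
  part′-v = insertAt-lookup part v i

  part′-punchIn : ∀ u → part′ (punchIn v u) ≡ part u
  part′-punchIn = insertAt-punchIn part v i

  count-part′ : ∀ j → count (λ w → part′ w ≟ j) ≡ ind (i ≟ j) + count (λ u → part u ≟ j)
  count-part′ j = trans (sum-remove {i = v} (λ w → ind (part′ w ≟ j)))
    (cong₂ _+_ (cong (λ x → ind (x ≟ j)) part′-v)
      (sum-cong-≗ λ u → cong (λ x → ind (x ≟ j)) (part′-punchIn u)))

  extended : Structure col k M
  extended = record
    { centre       = centre
    ; part         = part′
    ; k-centre     = trans (sym (lower-other k (i≢centre ∘ sym))) k-centre
    ; count-centre = trans (count-part′ centre)
                       (trans (cong (_+ count (λ u → part u ≟ centre)) (ind-no (i ≟ centre) i≢centre)) count-centre)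
    ; count-other  = count-other′
    ; inside       = λ {u} {w} → inside′ (punched v u) (punched v w)
    ; to-centre    = λ {u} {w} → to-centre′ (punched v u) (punched v w)
    ; across       = λ {u} {w} → across′ (punched v u) (punched v w)
    }
    where
    count-other′ : ∀ j → j ≢ centre → count (λ w → part′ w ≟ j) ≡ k j
    count-other′ j j≢centre with j ≟ i
    ... | yes refl = trans (count-part′ j) (trans (cong₂ _+_ (ind-yes (j ≟ j) refl) (count-other j j≢centre))
                       (suc-lower k 1≤ki))
    ... | no j≢i = trans (count-part′ j) (trans (cong₂ _+_ (ind-no (i ≟ j) (j≢i ∘ sym)) (count-other j j≢centre))
                       (lower-other k j≢i))

    inside′ : ∀ {u w} → Punched v u → Punched v w → u ≢ w → part′ u ≡ part′ w → col u w ≡ part′ u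
    inside′ here here v≢v _ = contradiction refl v≢v
    inside′ here (there w) _ e rewrite part′-v | part′-punchIn w with color-at-v w
    ... | inj₁ q = q
    ... | inj₂ (q , _) = trans q (sym e)
    inside′ (there u) here _ e rewrite part′-v | part′-punchIn u with color-at-v u
    ... | inj₁ q = trans (col-sym _ _) (trans q (sym e))
    ... | inj₂ (q , _) = trans (col-sym _ _) q
    inside′ (there u) (there w) u≢w e rewrite part′-punchIn u | part′-punchIn w =
      inside (u≢w ∘ cong (punchIn v)) e

    to-centre′ : ∀ {u w} → Punched v u → Punched v w → part′ u ≡ centre → part′ w ≢ centre → col u w ≡ part′ w
    to-centre′ here _ p _ rewrite part′-v = contradiction p i≢centre
    to-centre′ (there u) here p _ rewrite part′-v | part′-punchIn u with color-at-v u
    ... | inj₁ q = trans (col-sym _ _) q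
    ... | inj₂ (_ , ≢centre) = contradiction p ≢centre
    to-centre′ (there u) (there w) p q rewrite part′-punchIn u | part′-punchIn w = to-centre p q

    across′ : ∀ {u w} → Punched v u → Punched v w → part′ u ≢ centre → part′ w ≢ centre → part′ u ≢ part′ w →
      col u w ≡ part′ u ⊎ col u w ≡ part′ w
    across′ here here _ _ ne = contradiction refl ne
    across′ here (there w) _ _ _ rewrite part′-v | part′-punchIn w with color-at-v w
    ... | inj₁ q = inj₁ q
    ... | inj₂ (q , _) = inj₂ q
    across′ (there u) here _ _ _ rewrite part′-v | part′-punchIn u with color-at-v u
    ... | inj₁ q = inj₂ (trans (col-sym _ _) q)
    ... | inj₂ (q , _) = inj₁ (trans (col-sym _ _) q)
    across′ (there u) (there w) p q r rewrite part′-punchIn u | part′-punchIn w = across p q r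

one-color-structure : ∀ {c} (col : Coloring n c) (k : Fin c → ℕ) (M : ℕ) →
  (∃ λ i → k i ≡ M × ∀ j → j ≢ i → k j ≡ 0) → n ≡ sum k + M + 1 →
  (∀ i → ¬ Matching (Colored col i) U (suc (k i))) → Structure col k M
one-color-structure {n} col k M (i , ki≡M , others) n≡ maximum = record
  { centre       = i
  ; part         = λ _ → i
  ; k-centre     = ki≡M
  ; count-centre = trans (count-all (λ _ → i ≟ i) (λ _ → refl)) n≡2M+1
  ; count-other  = λ j j≢i → trans (count-none {n} {P = λ _ → i ≡ j} (λ _ → i ≟ j) (λ _ → j≢i ∘ sym)) (sym (others j j≢i))
  ; inside       = λ u≢v _ → monochromatic u≢v
  ; to-centre    = λ _ ≢i → contradiction refl ≢i
  ; across       = λ ≢i → contradiction refl ≢i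
  }
  where
  clear≡0 : ∀ j → clear i k j ≡ 0
  clear≡0 j with j ≟ i
  ... | yes _ = refl
  ... | no j≢i = others j j≢i
  sum≡M : sum k ≡ M
  sum≡M = trans (sum-clear k i) (trans (cong₂ _+_ ki≡M (sum-zero clear≡0)) (+-identityʳ M))
  n≡2M+1 : n ≡ suc (2 * M)
  n≡2M+1 = trans n≡ (trans (+-comm _ 1)
    (cong suc (trans (cong (_+ M) sum≡M) (cong (M +_) (sym (+-identityʳ M))))))
  monochromatic : ∀ {u v} → u ≢ v → col u v ≡ i
  monochromatic {u} {v} u≢v with col u v ≟ i
  ... | yes e = e
  ... | no ≢i = contradiction (subst (λ x → Matching (Colored col (col u v)) U (suc x))
    (sym (others (col u v) ≢i)) (edge u≢v _ _ refl [])) (maximum (col u v))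

structure : ∀ n {c} (col : Coloring n c) → Symmetric col → (k : Fin c → ℕ) (M : ℕ) → (∀ i → k i ≤ M) →
  sum k + M + 1 ≤ n → (∀ i → ¬ Matching (Colored col i) U (suc (k i))) →
  n ≡ sum k + M + 1 × Structure col k M
structure zero col col-sym k M k≤M large maximum =
  contradiction (≤-trans (m≤n+m 1 (sum k + M)) large) λ ()
structure (suc n) {c} col col-sym k M k≤M large maximum with any? (λ i → any? (λ v →
    1 ≤? k i ×-dec ¬? (matching? (λ a b → delete v col a b ≟ i) (λ _ → yes _) (k i))))
... | yes (i , v , 1≤ki , no-matching) =
  trans (cong suc (proj₁ smaller)) (cong (λ x → x + M + 1) (sum-lower k 1≤ki)) ,
  Extend.extended col col-sym k M k≤M maximum i v 1≤ki (proj₂ smaller)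
  where
  maximum′ : ∀ j → ¬ Matching (Colored (delete v col) j) U (suc (lower i k j))
  maximum′ j μ with j ≟ i
  ... | yes refl = no-matching (subst (Matching _ _) (m+[n∸m]≡n 1≤ki) μ)
  ... | no _ = maximum j (restore v _ μ)
  smaller : n ≡ sum (lower i k) + M + 1 × Structure (delete v col) (lower i k) M
  smaller = structure n (delete v col) (λ _ _ → col-sym _ _) (lower i k) M
    (λ j → ≤-trans (m∸n≤m (k j) (ind (j ≟ i))) (k≤M j))
    (≤-pred (≤-trans (≤-reflexive (cong (λ x → x + M + 1) (sum-lower k 1≤ki))) large)) maximum′
... | no none = proj₁ K.sizes , one-color-structure col k M K.one-color (proj₁ K.sizes) maximum
  where
  inessential : ∀ i v → Matching (Colored col i) (U ∖ v) (k i)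
  inessential i v with 1 ≤? k i | matching? (λ a b → delete v col a b ≟ i) (λ _ → yes _) (k i)
  ... | no 1≰ki | _     = subst (Matching _ _) (sym (n<1⇒n≡0 (≰⇒> 1≰ki))) []
  ... | yes _    | yes μ = restore v (λ _ → _ , punchInᵢ≢i v _) μ
  ... | yes 1≤ki | no ¬μ = contradiction (i , v , 1≤ki , ¬μ) none
  module K = Critical col col-sym k M k≤M large maximum inessential

mono-matching : ∀ {c} {col : Coloring n c} {i} → Matching (Colored col i) A k →
  Σ (MonoMatching col i k) λ (e , _) → ∀ l → A (proj₁ (e l)) × A (proj₂ (e l))
mono-matching [] = ((λ ()) , (λ ()) , (λ ()) , λ ()) , λ ()
mono-matching {n = n} (edge {k} {a} {b} a≢b x y e μ) with mono-matching μ
... | (f , f-≢ , f-color , f-disjoint) , f-in = (g , g-≢ , g-color , g-disjoint) , g-in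
  where
  g : Fin (suc k) → Fin n × Fin n
  g zero = a , b
  g (suc l) = f l
  g-≢ : ∀ l → proj₁ (g l) ≢ proj₂ (g l)
  g-≢ zero = a≢b
  g-≢ (suc l) = f-≢ l
  g-color : ∀ l → _
  g-color zero = e
  g-color (suc l) = f-color l
  g-in : ∀ l → _
  g-in zero = x , y
  g-in (suc l) with f-in l
  ... | ((p , _) , _) , ((q , _) , _) = p , q
  g-disjoint : ∀ l m → l ≢ m → _
  g-disjoint zero zero l≢m = contradiction refl l≢m
  g-disjoint zero (suc m) _ with f-in m
  ... | ((_ , p₁) , p₂) , ((_ , q₁) , q₂) = p₁ ∘ sym , q₁ ∘ sym , p₂ ∘ sym , q₂ ∘ sym
  g-disjoint (suc l) zero _ with f-in l
  ... | ((_ , p₁) , p₂) , ((_ , q₁) , q₂) = p₁ , p₂ , q₁ , q₂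
  g-disjoint (suc l) (suc m) l≢m = f-disjoint l m (l≢m ∘ cong suc)

relabel : ∀ {c} (ns : Fin (suc c) → ℕ) → (∀ i → 1 ≤ ns i) → {col : Coloring n (suc c)} →
  Structure col (λ i → ns i ∸ 1) (ns zero ∸ 1) →
  Σ (Permutation′ (suc c)) λ σ → Σ (Fin n → Fin (suc c)) λ p → Extremal ns (recolor σ col) p
relabel {n = n} {c} ns 1≤ns S =
  σ , (λ v → σ ⟨$⟩ʳ part v) , bijections ,
  (λ u v u≢v e → cong (σ ⟨$⟩ʳ_) (inside u≢v (σ-injective e))) ,
  (λ u v p q → cong (σ ⟨$⟩ʳ_) (to-centre (to-zero p) (q ∘ from-centre))) ,
  (λ u v p q r → Sum.map (cong (σ ⟨$⟩ʳ_)) (cong (σ ⟨$⟩ʳ_))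
    (across (p ∘ from-centre) (q ∘ from-centre) (r ∘ cong (σ ⟨$⟩ʳ_))))
  where
  open Structure S
  σ : Permutation′ (suc c)
  σ = transpose centre zero
  σ-injective : ∀ {i j} → σ ⟨$⟩ʳ i ≡ σ ⟨$⟩ʳ j → i ≡ j
  σ-injective e = trans (sym (inverseˡ σ)) (trans (cong (σ ⟨$⟩ˡ_) e) (inverseˡ σ))
  σ-centre : σ ⟨$⟩ʳ centre ≡ zero
  σ-centre = inverseʳ σ {zero}
  from-centre : ∀ {i} → i ≡ centre → σ ⟨$⟩ʳ i ≡ zero
  from-centre refl = σ-centre
  to-zero : ∀ {i} → σ ⟨$⟩ʳ i ≡ zero → i ≡ centre
  to-zero e = σ-injective (trans e (sym σ-centre))
  counts : ∀ i → count (λ v → σ ⟨$⟩ʳ part v ≟ i) ≡ partSize ns i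
  counts zero = trans (count-cong (λ v → σ ⟨$⟩ʳ part v ≟ zero) (λ v → part v ≟ centre) to-zero from-centre)
    (trans count-centre (trans (sym (+-suc a (a + 0))) (cong (λ x → 2 * x ∸ 1) (m+[n∸m]≡n (1≤ns zero)))))
    where
    a : ℕ
    a = ns zero ∸ 1
  counts (suc i) = trans
    (count-cong (λ v → σ ⟨$⟩ʳ part v ≟ suc i) (λ v → part v ≟ j)
      (λ e → trans (sym (inverseˡ σ)) (cong (σ ⟨$⟩ˡ_) e)) (λ e → trans (cong (σ ⟨$⟩ʳ_) e) (inverseʳ σ {suc i})))
    (trans (count-other j j≢centre) size-j)
    where
    j : Fin (suc c)
    j = σ ⟨$⟩ˡ suc i
    j≢centre : j ≢ centre
    j≢centre e with trans (sym (inverseʳ σ {suc i})) (from-centre e)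
    ... | ()
    size-j : ns j ∸ 1 ≡ ns (suc i) ∸ 1
    size-j with suc i ≟ centre
    ... | yes e = trans (sym k-centre) (cong (λ x → ns x ∸ 1) (sym e))
    ... | no _ = refl
  bijections : ∀ i → Fin (partSize ns i) ↔ Σ (Fin n) (λ v → σ ⟨$⟩ʳ part v ≡ i)
  bijections i = subst (λ x → Fin x ↔ Σ (Fin n) (λ v → σ ⟨$⟩ʳ part v ≡ i)) (counts i)
    (count-↔ (λ v → σ ⟨$⟩ʳ part v ≟ i) λ { refl refl → refl })

theorem1 : (c : ℕ) (ns : Fin (suc c) → ℕ) →
    (∀ i → 1 ≤ ns i) →
    (∀ i j → i F.≤ j → ns j ≤ ns i) →
    (n : ℕ) → ns zero + sumFin (λ i → ns i ∸ 1) ≤ n →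
    (col : Coloring n (suc c)) → Symmetric col →
    (∀ i → ¬ MonoMatching col i (ns i)) →
    (n ≡ ns zero + sumFin (λ i → ns i ∸ 1)) ×
    Σ (Permutation′ (suc c)) (λ σ →
    Σ (Fin n → Fin (suc c)) (λ p → Extremal ns (recolor σ col) p))
theorem1 c ns 1≤ns ns-mono n large col col-sym no-mono =
  trans (proj₁ result) (sym size) , relabel ns 1≤ns (proj₂ result)
  where
  ks : Fin (suc c) → ℕ
  ks i = ns i ∸ 1
  suc-ks : ∀ i → suc (ks i) ≡ ns i
  suc-ks i = m+[n∸m]≡n (1≤ns i)
  size : ns zero + sumFin ks ≡ sum ks + ks zero + 1
  size = trans (cong₂ _+_ (sym (suc-ks zero)) (sumFin≡sum ks)) (rearranged (ks zero) (sum ks))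
    where
    rearranged : ∀ a b → 1 + a + b ≡ b + a + 1
    rearranged = solve-∀
  result : n ≡ sum ks + ks zero + 1 × Structure col ks (ks zero)
  result = structure n col col-sym ks (ks zero) (λ i → ∸-monoˡ-≤ 1 (ns-mono zero i z≤n))
    (≤-trans (≤-reflexive (sym size)) large)
    (λ i μ → no-mono i (proj₁ (mono-matching (subst (Matching _ _) (suc-ks i) μ))))
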